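{- Let $r \geq 2$ be an integer, $m = r^{\binom{r+1}{2}} - \lfloor r/4 \rfloor \cdot r^{\binom{r}{2}} + 1$ and $n = \left\lceil \frac12 \cdot r^{\binom{r+1}{2}} \right\rceil$. Then $g(m,n) \geq r+1$. In particular, $G(r) \leq r^{\binom{r+1}{2}} - \left(\frac14 - o(1)\right) r^{\binom{r}{2}+1}$, where $o(1)$ denotes a quantity tending to $0$ as $r \to \infty$.
   Context: For positive integers $m,n$, the grid graph $\Gamma_{m,n} = K_m \times K_n$ has vertex set $[m]\times[n]$ (where $[k]=\{1,\dots,k\}$), and two distinct vertices $(i,j)$, $(i',j')$ are adjacent if and only if $i=i'$ or $j=j'$. A rectangle is a set of four vertices $\{(i,j),(i',j),(i,j'),(i',j')\}$ with $1\le i<i'\le m$ and $1\le j<j'\le n$. Given a colouring of $E(\Gamma_{m,n})$, a rectangle is called alternating if its parallel edges receive the same colour, that is, the edges $\{(i,j),(i',j)\}$ and $\{(i,j'),(i',j')\}$ have the same colour, and the edges $\{(i,j),(i,j')\}$ and $\{(i',j),(i',j')\}$ have the same colour. An $r$-colouring is an arbitrary (not necessarily proper) assignment of colours from a set of $r$ colours. For positive integers $m,n$, $g(m,n)$ is the smallest number $r$ such that there exists an $r$-colouring of $E(\Gamma_{m,n})$ without alternating rectangles. $G(r)$ is the smallest number $n$ such that every $r$-colouring of $E(\Gamma_{n,n})$ induces an alternating rectangle. -}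

module Defs where

open import Data.Fin as Fin using (Fin; zero; suc; combine; remQuot; finToFun; funToFin; _↑ˡ_; _↑ʳ_)
import Data.Fin.Properties as Fin
open import Data.Integer using (+_)
open import Data.Nat as ℕ using (ℕ; zero; suc; _+_; _*_; _^_; _≤_; z≤n; s≤s)
import Data.Nat.Properties as ℕ
open import Data.Product using (Σ-syntax; ∃; ∃-syntax; _×_; _,_; proj₁; proj₂; uncurry)
open import Data.Product.Properties using (≡-dec)
open import Data.Rational as ℚ using (ℚ; 0ℚ)
open import Data.Sum as Sum using (_⊎_; inj₁; inj₂)
open import Function using (_∘_)
open import Level using (0ℓ)
open import Relation.Binary.PropositionalEquality
open import Relation.Nullary
open import Relation.Nullary.Negation.Core using (contradiction-irr)
open import Relation.Nullary.Decidable using (map′; decidable-stable)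
open import Relation.Unary using (Pred; Decidable)
import Algebra.Construct.NaturalChoice.Min as Min

Vertex : ℕ → ℕ → Set
Vertex m n = Fin m × Fin n

Adjacent : ∀ {m n} → Vertex m n → Vertex m n → Set
Adjacent (i , j) (i′ , j′) = (i , j) ≢ (i′ , j′) × (i ≡ i′ ⊎ j ≡ j′)

adjacent-sym : ∀ {m n} {u v : Vertex m n} → Adjacent u v → Adjacent v u
adjacent-sym (u≢v , e) = u≢v ∘ sym , Sum.map sym sym e

-- Edges are unordered pairs of adjacent vertices: the colour may depend neither
-- on the proof of adjacency (irrelevance) nor on the order of the endpoints.
record Colouring (m n r : ℕ) : Set where
  field
    colour    : (u v : Vertex m n) → .(Adjacent u v) → Fin r
    symmetric : ∀ u v .(a : Adjacent u v) → colour u v a ≡ colour v u (adjacent-sym a)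

open Colouring public

sameColumn : ∀ {m n} {i i′ : Fin m} {j : Fin n} → i ≢ i′ → Adjacent (i , j) (i′ , j)
sameColumn i≢i′ = i≢i′ ∘ cong proj₁ , inj₂ refl

sameRow : ∀ {m n} {i : Fin m} {j j′ : Fin n} → j ≢ j′ → Adjacent (i , j) (i , j′)
sameRow j≢j′ = j≢j′ ∘ cong proj₂ , inj₁ refl

Alternating : ∀ {m n r} → Colouring m n r →
              (i i′ : Fin m) → i Fin.< i′ → (j j′ : Fin n) → j Fin.< j′ → Set
Alternating c i i′ i<i′ j j′ j<j′ =
    colour c (i , j) (i′ , j) (sameColumn (Fin.<⇒≢ i<i′))
      ≡ colour c (i , j′) (i′ , j′) (sameColumn (Fin.<⇒≢ i<i′))
  × colour c (i , j) (i , j′) (sameRow (Fin.<⇒≢ j<j′))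
      ≡ colour c (i′ , j) (i′ , j′) (sameRow (Fin.<⇒≢ j<j′))

HasAlternating : ∀ {m n r} → Colouring m n r → Set
HasAlternating {m} {n} c =
  Σ[ i ∈ Fin m ] Σ[ i′ ∈ Fin m ] Σ[ i<i′ ∈ i Fin.< i′ ]
  Σ[ j ∈ Fin n ] Σ[ j′ ∈ Fin n ] Σ[ j<j′ ∈ j Fin.< j′ ]
  Alternating c i i′ i<i′ j j′ j<j′

Avoidable : ℕ → ℕ → ℕ → Set
Avoidable m n r = Σ[ c ∈ Colouring m n r ] ¬ HasAlternating c

Unavoidable : ℕ → ℕ → Set
Unavoidable r n = (c : Colouring n n r) → HasAlternating c

IsLeast : Pred ℕ 0ℓ → ℕ → Set
IsLeast P n = P n × (∀ k → P k → n ≤ k)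

least : {P : Pred ℕ 0ℓ} → Decidable P → ∃ P → ∃ (IsLeast P)
least {P} P? (n , p) = go P? n p
  where
  go : {P : Pred ℕ 0ℓ} → Decidable P → ∀ n → P n → ∃ (IsLeast P)
  go P? zero p = zero , p , λ _ _ → z≤n
  go P? (suc n) p with P? zero
  ... | yes p₀ = zero , p₀ , λ _ _ → z≤n
  ... | no ¬p₀ with go (P? ∘ suc) n p
  ...   | l , pl , l≤ = suc l , pl , λ where
            zero    p₀ → contradiction p₀ ¬p₀
            (suc k) pk → s≤s (l≤ k pk)

_≟ᵛ_ : ∀ {m n} (u v : Vertex m n) → Dec (u ≡ v)
_≟ᵛ_ = ≡-dec Fin._≟_ Fin._≟_

adjacent? : ∀ {m n} (u v : Vertex m n) → Dec (Adjacent u v)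
adjacent? u@(i , j) v@(i′ , j′) = ¬? (u ≟ᵛ v) ×-dec (i Fin.≟ i′ ⊎-dec j Fin.≟ j′)

anyVertex? : ∀ {m n} {P : Vertex m n → Set} → (∀ v → Dec (P v)) → Dec (∃ P)
anyVertex? P? =
  map′ (λ (i , j , p) → (i , j) , p) (λ ((i , j) , p) → i , j , p)
       (Fin.any? λ i → Fin.any? λ j → P? (i , j))

allVertices? : ∀ {m n} {P : Vertex m n → Set} → (∀ v → Dec (P v)) → Dec (∀ v → P v)
allVertices? P? =
  map′ (λ p (i , j) → p i j) (λ p i j → p (i , j))
       (Fin.all? λ i → Fin.all? λ j → P? (i , j))

any<? : ∀ {n} {P : (i j : Fin n) → i Fin.< j → Set} →
        (∀ i j i<j → Dec (P i j i<j)) →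
        Dec (Σ[ i ∈ Fin n ] Σ[ j ∈ Fin n ] Σ[ i<j ∈ i Fin.< j ] P i j i<j)
any<? {P = P} P? = Fin.any? λ i → Fin.any? λ j → below i j (i Fin.<? j)
  where
  below : ∀ i j → Dec (i Fin.< j) → Dec (Σ[ i<j ∈ i Fin.< j ] P i j i<j)
  below i j (no i≮j)  = no (i≮j ∘ proj₁)
  below i j (yes i<j) =
    map′ (i<j ,_) (λ (q , p) → subst (P i j) (ℕ.<-irrelevant q i<j) p) (P? i j i<j)

hasAlternating? : ∀ {m n r} (c : Colouring m n r) → Dec (HasAlternating c)
hasAlternating? c =
  any<? λ i i′ _ → any<? λ j j′ _ → (_ Fin.≟ _) ×-dec (_ Fin.≟ _)

_≈_ : ∀ {m n r} → Colouring m n r → Colouring m n r → Set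
c ≈ d = ∀ u v .(a : Adjacent u v) → colour c u v a ≡ colour d u v a

hasAlternating-resp : ∀ {m n r} {c d : Colouring m n r} →
                      c ≈ d → HasAlternating c → HasAlternating d
hasAlternating-resp c≈d (i , i′ , i<i′ , j , j′ , j<j′ , p , q) =
  i , i′ , i<i′ , j , j′ , j<j′ ,
  trans (sym (c≈d _ _ _)) (trans p (c≈d _ _ _)) ,
  trans (sym (c≈d _ _ _)) (trans q (c≈d _ _ _))

-- With a colour available, colour functions extend to all pairs of vertices and
-- are then enumerated by finToFun.
module _ {m n r : ℕ} where

  private
    Code : Set
    Code = Fin (suc r ^ (m * n * (m * n)))

  decode : Code → Vertex m n → Vertex m n → Fin (suc r)
  decode f u v = finToFun f (combine (uncurry combine u) (uncurry combine v))

  encode : (Vertex m n → Vertex m n → Fin (suc r)) → Code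
  encode h = funToFin λ k →
    let (x , y) = remQuot (m * n) k in h (remQuot n x) (remQuot n y)

  decode-encode : ∀ h u v → decode (encode h) u v ≡ h u v
  decode-encode h (i , j) (i′ , j′) = trans
    (Fin.finToFun-funToFin _ (combine (combine i j) (combine i′ j′)))
    (trans
      (cong (λ (x , y) → h (remQuot n x) (remQuot n y))
            (Fin.remQuot-combine (combine i j) (combine i′ j′)))
      (cong₂ h (Fin.remQuot-combine i j) (Fin.remQuot-combine i′ j′)))

  SymmetricCode : Code → Set
  SymmetricCode f = ∀ u v → decode f u v ≡ decode f v u

  fromCode : (f : Code) → SymmetricCode f → Colouring m n (suc r)
  fromCode f s = record { colour = λ u v _ → decode f u v ; symmetric = λ u v _ → s u v }

  AvoidingCode : Code → Set
  AvoidingCode f = Σ[ s ∈ SymmetricCode f ] ¬ HasAlternating (fromCode f s)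

  avoidingCode? : Decidable AvoidingCode
  avoidingCode? f with allVertices? (λ u → allVertices? (λ v → decode f u v Fin.≟ decode f v u))
  ... | no ¬s = no (¬s ∘ proj₁)
  ... | yes s = map′ (s ,_) (λ (_ , ¬alt) → ¬alt) (¬? (hasAlternating? (fromCode f s)))

  total : Colouring m n (suc r) → Vertex m n → Vertex m n → Fin (suc r)
  total c u v with adjacent? u v
  ... | yes a = colour c u v a
  ... | no _  = zero

  total-adjacent : ∀ c u v .(a : Adjacent u v) → total c u v ≡ colour c u v a
  total-adjacent c u v a with adjacent? u v
  ... | yes _ = refl
  ... | no ¬a = contradiction-irr a ¬a

  total-sym : ∀ c u v → total c u v ≡ total c v u
  total-sym c u v with adjacent? u v | adjacent? v u
  ... | yes a | yes _ = symmetric c u v a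
  ... | yes a | no ¬a = contradiction (adjacent-sym a) ¬a
  ... | no ¬a | yes a = contradiction (adjacent-sym a) ¬a
  ... | no _  | no _  = refl

  toCode : Avoidable m n (suc r) → ∃ AvoidingCode
  toCode (c , ¬alt) = encode (total c) , s , ¬alt ∘ hasAlternating-resp {c = fromCode _ s} {d = c} code≈c
    where
    s : SymmetricCode (encode (total c))
    s u v = trans (decode-encode (total c) u v)
              (trans (total-sym c u v) (sym (decode-encode (total c) v u)))

    code≈c : fromCode (encode (total c)) s ≈ c
    code≈c u v a = trans (decode-encode (total c) u v) (total-adjacent c u v a)

avoidable? : ∀ m n → Decidable (Avoidable m n)
avoidable? m n (suc r) =
  map′ (λ (f , s , ¬alt) → fromCode f s , ¬alt) toCode (Fin.any? avoidingCode?)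
avoidable? m n zero with anyVertex? (λ u → anyVertex? (λ v → adjacent? u v))
... | yes (u , v , a) = no λ (c , _) → Fin.¬Fin0 (colour c u v a)
... | no edgeless     = yes (c , λ (i , i′ , i<i′ , j , _) →
        edgeless ((i , j) , (i′ , j) , sameColumn (Fin.<⇒≢ i<i′)))
  where
  c : Colouring m n 0
  c = record
    { colour    = λ u v a → contradiction-irr (u , v , a) edgeless
    ; symmetric = λ u v a → contradiction-irr (u , v , a) edgeless
    }

unavoidable? : ∀ r → Decidable (Unavoidable r)
unavoidable? r n =
  map′ (λ ¬av c → decidable-stable (hasAlternating? c) (λ ¬alt → ¬av (c , ¬alt)))
       (λ un (c , ¬alt) → ¬alt (un c))
       (¬? (avoidable? n n r))

-- Colouring each edge by the smaller column of its endpoints.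
avoidable : ∀ m n → ∃ (Avoidable m n)
avoidable m n = n , c , λ (_ , _ , _ , j , j′ , j<j′ , p , _) →
    Fin.<⇒≢ j<j′ (trans (sym (⊓-idem j)) (trans p (⊓-idem j′)))
  where
  open Min (Fin.≤-totalOrder n) using (_⊓_; ⊓-comm; ⊓-idem)

  c : Colouring m n n
  c = record
    { colour    = λ (_ , j) (_ , j′) _ → j ⊓ j′
    ; symmetric = λ (_ , j) (_ , j′) _ → ⊓-comm j j′
    }

-- Two of sufficiently many rows agree on the first r + 1 columns, and two of the
-- r + 1 edges joining them inside a column have the same colour.
unavoidable : ∀ r → ∃ (Unavoidable r)
unavoidable r = q + suc (suc r ^ (q * q)) , alternating
  where
  q = suc r

  alternating : Unavoidable r (q + suc (suc r ^ (q * q)))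
  alternating c = i , i′ , i<i′ , col j , col j′ , j<j′ , columnsAgree , rowsAgree
    where
    row = q ↑ʳ_
    col = _↑ˡ suc (suc r ^ (q * q))

    col-mono : ∀ {j j′} → j Fin.< j′ → col j Fin.< col j′
    col-mono {j} {j′} = subst₂ ℕ._<_ (sym (Fin.toℕ-↑ˡ j _)) (sym (Fin.toℕ-↑ˡ j′ _))

    row-mono : ∀ {i i′} → i Fin.< i′ → row i Fin.< row i′
    row-mono {i} {i′} =
      subst₂ ℕ._<_ (sym (Fin.toℕ-↑ʳ q i)) (sym (Fin.toℕ-↑ʳ q i′)) ∘ ℕ.+-monoʳ-< q

    entry : ∀ i (jj : Fin q × Fin q) → Dec (proj₁ jj ≡ proj₂ jj) → Fin (suc r)
    entry i (j , j′) (yes _)   = zero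
    entry i (j , j′) (no j≢j′) =
      suc (colour c (row i , col j) (row i , col j′) (sameRow (j≢j′ ∘ Fin.↑ˡ-injective _ j j′)))

    pattern′ : Fin (suc (suc r ^ (q * q))) → Fin q × Fin q → Fin (suc r)
    pattern′ i jj = entry i jj (proj₁ jj Fin.≟ proj₂ jj)

    rows = Fin.pigeonhole ℕ.≤-refl λ i → funToFin (pattern′ i ∘ remQuot {q} q)
    i₀ = proj₁ rows
    i₁ = proj₁ (proj₂ rows)
    i = row i₀
    i′ = row i₁
    i<i′ = row-mono {i₀} {i₁} (proj₁ (proj₂ (proj₂ rows)))

    cols = Fin.pigeonhole ℕ.≤-refl λ j →
      colour c (i , col j) (i′ , col j) (sameColumn (Fin.<⇒≢ i<i′))
    j = proj₁ cols
    j′ = proj₁ (proj₂ cols)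
    j<j′ = col-mono {j} {j′} (proj₁ (proj₂ (proj₂ cols)))
    columnsAgree = proj₂ (proj₂ (proj₂ cols))

    patternsAgree : pattern′ i₀ (j , j′) ≡ pattern′ i₁ (j , j′)
    patternsAgree = begin
      pattern′ i₀ (j , j′)
        ≡⟨ cong (pattern′ i₀) (Fin.remQuot-combine j j′) ⟨
      pattern′ i₀ (remQuot q k)
        ≡⟨ Fin.finToFun-funToFin (pattern′ i₀ ∘ remQuot {q} q) k ⟨
      finToFun (funToFin (pattern′ i₀ ∘ remQuot {q} q)) k
        ≡⟨ cong (λ f → finToFun f k) (proj₂ (proj₂ (proj₂ rows))) ⟩
      finToFun (funToFin (pattern′ i₁ ∘ remQuot {q} q)) k
        ≡⟨ Fin.finToFun-funToFin (pattern′ i₁ ∘ remQuot {q} q) k ⟩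
      pattern′ i₁ (remQuot q k)
        ≡⟨ cong (pattern′ i₁) (Fin.remQuot-combine j j′) ⟩
      pattern′ i₁ (j , j′) ∎
      where
      open ≡-Reasoning
      k = combine j j′

    entriesAgree : ∀ d → entry i₀ (j , j′) d ≡ entry i₁ (j , j′) d →
      colour c (i , col j) (i , col j′) (sameRow (Fin.<⇒≢ j<j′))
        ≡ colour c (i′ , col j) (i′ , col j′) (sameRow (Fin.<⇒≢ j<j′))
    entriesAgree (yes j≡j′) _ = contradiction (cong col j≡j′) (Fin.<⇒≢ j<j′)
    entriesAgree (no _)     e = Fin.suc-injective e

    rowsAgree = entriesAgree (j Fin.≟ j′) patternsAgree

-- The grid sizes m, n, number of colours r and values range over all of ℕ. Allowing
-- zero changes no value at positive arguments except g 1 1 = 0 (there are no edges),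
-- as grids of size 0 and 1 contain no rectangle.
g : ℕ → ℕ → ℕ
g m n = proj₁ (least (avoidable? m n) (avoidable m n))

g-isLeast : ∀ m n → IsLeast (Avoidable m n) (g m n)
g-isLeast m n = proj₂ (least (avoidable? m n) (avoidable m n))

G : ℕ → ℕ
G r = proj₁ (least (unavoidable? r) (unavoidable r))

G-isLeast : ∀ r → IsLeast (Unavoidable r) (G r)
G-isLeast r = proj₂ (least (unavoidable? r) (unavoidable r))

fromℕ : ℕ → ℚ
fromℕ n = + n ℚ./ 1

TendsToZero : (ℕ → ℚ) → Set
TendsToZero ε = ∀ δ → 0ℚ ℚ.< δ → ∃[ N ] (∀ r → N ≤ r → ℚ.∣ ε r ∣ ℚ.< δ)

{-# OPTIONS --safe #-}
module Submission where

-- In a colouring without alternating rectangles, two rows never agree on all pairs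
-- from a set of r + 1 columns: two of the edges joining them inside those columns
-- would have the same colour. For r < 4 the rows are therefore injectively coded by
-- their restrictions to r + 1 columns. For r ≥ 4 fix r - 1 base columns. By
-- pigeonhole more than r^(2r-1) - ⌊r/4⌋ r^(r-1) rows look alike on the base. Each
-- further column j assigns to every such row the word of its colours between j and
-- the base, one of q = r^(r-1) words; two columns assign a common pair of words to
-- at most r rows, since such rows have distinct colours between the two columns.
-- This is an orthogonal-array-like structure, and the second-moment argument of
-- Bose and Bush shows that with (r + 1) q columns it has too few rows.

open import Defs
open import Data.Bool using (if_then_else_)
open import Data.Fin as Fin using (Fin; zero; suc; combine; finToFun; funToFin; inject≤; _↑ˡ_; _↑ʳ_)
import Data.Fin.Properties as Fin
import Data.Integer.Properties as ℤ
open import Data.Nat using (ℕ; NonZero; >-nonZero; zero; suc; _+_; _∸_; _*_; _^_; _≤_; _<_; _≥_; _/_; _%_; ⌊_/2⌋; ⌈_/2⌉; z≤n; s≤s; s≤s⁻¹)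
open import Data.Nat.Combinatorics using (_C_; nC1≡n; nCk+nC[k+1]≡[n+1]C[k+1])
open import Data.Nat.DivMod using (m/n*n≤m; m/n≤m; m≡m%n+[m/n]*n; m%n<n)
import Data.Nat.Properties as ℕ
open import Data.Nat.Tactic.RingSolver using (solve-∀)
open import Data.Product using (Σ-syntax; ∃-syntax; _×_; _,_; proj₁; proj₂)
open import Data.Rational as ℚ using (ℚ; 0ℚ; mkℚ; toℚᵘ; *<*)
import Data.Rational.Properties as ℚ
open import Data.Rational.Solver using (module +-*-Solver)
open import Data.Rational.Unnormalised as ℚᵘ using (mkℚᵘ; *≡*; *≤*)
import Data.Rational.Unnormalised.Properties as ℚᵘ
open import Algebra.Properties.Semiring.Sum ℕ.+-*-semiring using (sum; sum-cong-≗; ∑-comm; *-distribˡ-sum; *-distribʳ-sum; ∑-distrib-+)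
open import Function using (_∘_; Injective)
open import Relation.Binary.Definitions using (tri<; tri≈; tri>)
open import Relation.Binary.PropositionalEquality
open import Relation.Binary.PropositionalEquality.Properties using (subst-injective)
open import Relation.Nullary using (yes; no; does; contradiction; ¬_)
open import Relation.Nullary.Decidable using (decidable-stable)

-- Finite sums and counting

sum-mono-≤ : ∀ {n} {f g : Fin n → ℕ} → (∀ x → f x ≤ g x) → sum f ≤ sum g
sum-mono-≤ {zero}  f≤g = z≤n
sum-mono-≤ {suc n} f≤g = ℕ.+-mono-≤ (f≤g zero) (sum-mono-≤ (f≤g ∘ suc))

-- The exceptional summand moves to the other side, so that no subtraction occurs.
sum-mono-except : ∀ {n} {f g : Fin n → ℕ} x → (∀ y → y ≢ x → f y ≤ g y) →
                  sum f + g x ≤ f x + sum g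
sum-mono-except {f = f} {g} zero f≤g = begin
  f zero + sum (f ∘ suc) + g zero   ≡⟨ ℕ.+-assoc (f zero) _ _ ⟩
  f zero + (sum (f ∘ suc) + g zero) ≡⟨ cong (f zero +_) (ℕ.+-comm _ (g zero)) ⟩
  f zero + (g zero + sum (f ∘ suc)) ≤⟨ ℕ.+-monoʳ-≤ (f zero) (ℕ.+-monoʳ-≤ (g zero)
                                         (sum-mono-≤ λ y → f≤g (suc y) λ ())) ⟩
  f zero + (g zero + sum (g ∘ suc)) ∎
  where open ℕ.≤-Reasoning
sum-mono-except {f = f} {g} (suc x) f≤g = begin
  f zero + sum (f ∘ suc) + g (suc x)   ≡⟨ ℕ.+-assoc (f zero) _ _ ⟩
  f zero + (sum (f ∘ suc) + g (suc x)) ≤⟨ ℕ.+-mono-≤ (f≤g zero λ ())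
    (sum-mono-except x λ y y≢x → f≤g (suc y) (y≢x ∘ Fin.suc-injective)) ⟩
  g zero + (f (suc x) + sum (g ∘ suc)) ≡⟨ ring (g zero) (f (suc x)) _ ⟩
  f (suc x) + (g zero + sum (g ∘ suc)) ∎
  where
  open ℕ.≤-Reasoning
  ring : ∀ a b c → a + (b + c) ≡ b + (a + c)
  ring = solve-∀

sum-const : ∀ n b → sum {n} (λ _ → b) ≡ n * b
sum-const zero    b = refl
sum-const (suc n) b = cong (b +_) (sum-const n b)

exceeds-mean : ∀ {n} (f : Fin n → ℕ) b → n * b < sum f → ∃[ x ] b < f x
exceeds-mean {n} f b nb<f with Fin.any? (λ x → b ℕ.<? f x)
... | yes found = found
... | no  none  = contradiction nb<f (ℕ.≤⇒≯ (begin
  sum f              ≤⟨ sum-mono-≤ (λ x → ℕ.≮⇒≥ λ b<fx → none (x , b<fx)) ⟩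
  sum {n} (λ _ → b)  ≡⟨ sum-const n b ⟩
  n * b              ∎))
  where open ℕ.≤-Reasoning

-- Lowering both arguments by one keeps (a - b)² fixed, so the induction stays within ℕ.
2*≤²+² : ∀ a b → 2 * (a * b) ≤ a * a + b * b
2*≤²+² zero    b       = z≤n
2*≤²+² (suc a) zero    = ℕ.≤-trans (ℕ.≤-reflexive (cong (2 *_) (ℕ.*-zeroʳ a))) z≤n
2*≤²+² (suc a) (suc b) = begin
  2 * (suc a * suc b)               ≡⟨ ring₁ a b ⟩
  2 * (a * b) + (2 + 2 * a + 2 * b) ≤⟨ ℕ.+-monoˡ-≤ _ (2*≤²+² a b) ⟩
  a * a + b * b + (2 + 2 * a + 2 * b) ≡⟨ ring₂ a b ⟩
  suc a * suc a + suc b * suc b     ∎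
  where
  open ℕ.≤-Reasoning
  ring₁ : ∀ a b → 2 * ((1 + a) * (1 + b)) ≡ 2 * (a * b) + (2 + 2 * a + 2 * b)
  ring₁ = solve-∀
  ring₂ : ∀ a b → a * a + b * b + (2 + 2 * a + 2 * b) ≡ (1 + a) * (1 + a) + (1 + b) * (1 + b)
  ring₂ = solve-∀

-- Induction on `n`: the cross term `2 * (f₀ * F)` is spread over the tail and bounded summand by
-- summand with `2*≤²+²`.
cauchy-schwarz : ∀ {n} (f : Fin n → ℕ) → sum f * sum f ≤ n * sum (λ x → f x * f x)
cauchy-schwarz {zero}  f = z≤n
cauchy-schwarz {suc n} f = begin
  (f₀ + F) * (f₀ + F)                        ≡⟨ ring₁ f₀ F ⟩
  f₀ * f₀ + 2 * (f₀ * F) + F * F             ≤⟨ ℕ.+-mono-≤ (ℕ.+-monoʳ-≤ (f₀ * f₀) cross) (cauchy-schwarz (f ∘ suc)) ⟩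
  f₀ * f₀ + (n * (f₀ * f₀) + F²) + n * F²    ≡⟨ ring₂ f₀ n F² ⟩
  (1 + n) * (f₀ * f₀ + F²)                   ∎
  where
  open ℕ.≤-Reasoning
  f₀ = f zero
  F  = sum (f ∘ suc)
  F² = sum (λ x → f (suc x) * f (suc x))
  ring₁ : ∀ a b → (a + b) * (a + b) ≡ a * a + 2 * (a * b) + b * b
  ring₁ = solve-∀
  ring₂ : ∀ a n s → a * a + (n * (a * a) + s) + n * s ≡ (1 + n) * (a * a + s)
  ring₂ = solve-∀
  cross : 2 * (f₀ * F) ≤ n * (f₀ * f₀) + F²
  cross = begin
    2 * (f₀ * F)                                    ≡⟨ cong (2 *_) (*-distribˡ-sum f₀ (f ∘ suc)) ⟩
    2 * sum (λ x → f₀ * f (suc x))                  ≡⟨ *-distribˡ-sum 2 (λ x → f₀ * f (suc x)) ⟩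
    sum (λ x → 2 * (f₀ * f (suc x)))                ≤⟨ sum-mono-≤ (λ x → 2*≤²+² f₀ (f (suc x))) ⟩
    sum (λ x → f₀ * f₀ + f (suc x) * f (suc x))     ≡⟨ ∑-distrib-+ {n} (λ _ → f₀ * f₀) _ ⟩
    sum {n} (λ _ → f₀ * f₀) + F²                    ≡⟨ cong (_+ F²) (sum-const n (f₀ * f₀)) ⟩
    n * (f₀ * f₀) + F²                              ∎

-- Indicators, fibres and agreement counts

δ : ∀ {q} → Fin q → Fin q → ℕ
δ x y = if does (x Fin.≟ y) then 1 else 0

δ-refl : ∀ {q} (x : Fin q) → δ x x ≡ 1
δ-refl zero    = refl
δ-refl (suc x) = δ-refl x

δ≤1 : ∀ {q} (x y : Fin q) → δ x y ≤ 1
δ≤1 x y with x Fin.≟ y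
... | yes _ = ℕ.≤-refl
... | no  _ = z≤n

δ≢0⇒≡ : ∀ {q} (x y : Fin q) → δ x y ≢ 0 → x ≡ y
δ≢0⇒≡ x y δ≢0 with x Fin.≟ y
... | yes x≡y = x≡y
... | no  _   = contradiction refl δ≢0

δ-idem : ∀ {q} (x y : Fin q) → δ x y * δ x y ≡ δ x y
δ-idem x y with x Fin.≟ y
... | yes _ = refl
... | no  _ = refl

sum-δ : ∀ {q} (x : Fin q) (f : Fin q → ℕ) → sum (λ v → δ v x * f v) ≡ f x
sum-δ {suc q} zero f = begin
  f zero + 0 + sum {q} (λ _ → 0) ≡⟨ cong (f zero + 0 +_) (trans (sum-const q 0) (ℕ.*-zeroʳ q)) ⟩
  f zero + 0 + 0                 ≡⟨ trans (ℕ.+-identityʳ _) (ℕ.+-identityʳ _) ⟩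
  f zero                         ∎
  where open ≡-Reasoning
sum-δ (suc x) f = sum-δ x (f ∘ suc)

-- Turns a count written as a sum of zero-one weights back into distinct points of the support, to
-- which pigeonhole applies.
select : ∀ {n} (w : Fin n → ℕ) → (∀ x → w x ≤ 1) → ∀ {t} → t ≤ sum w →
         ∃[ σ ] Injective {A = Fin t} _≡_ _≡_ σ × (∀ x → w (σ x) ≢ 0)
select {zero}  w w≤1 z≤n = (λ ()) , (λ { {()} }) , λ ()
select {suc n} w w≤1 {t} t≤w with w zero in w₀ | w≤1 zero
... | zero | _ with select (w ∘ suc) (w≤1 ∘ suc) t≤w
...   | σ , inj , w≢0 = suc ∘ σ , inj ∘ Fin.suc-injective , w≢0
select {suc n} w w≤1 {zero}  t≤w | suc zero | _ = (λ ()) , (λ { {()} }) , λ ()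
select {suc n} w w≤1 {suc t} t≤w | suc zero | _ with select (w ∘ suc) (w≤1 ∘ suc) (s≤s⁻¹ t≤w)
...   | σ , inj , w≢0 = σ′ , inj′ , w≢0′
  where
  σ′ : Fin (suc t) → Fin (suc n)
  σ′ zero    = zero
  σ′ (suc x) = suc (σ x)
  inj′ : Injective _≡_ _≡_ σ′
  inj′ {zero}  {zero}  _ = refl
  inj′ {suc x} {suc y} e = cong suc (inj (Fin.suc-injective e))
  w≢0′ : ∀ x → w (σ′ x) ≢ 0
  w≢0′ zero    e = contradiction (trans (sym w₀) e) λ ()
  w≢0′ (suc x) = w≢0 x
select w w≤1 t≤w | suc (suc _) | s≤s ()

sum-fibres : ∀ {n q} (f : Fin n → Fin q) → sum (λ v → sum (λ i → δ v (f i))) ≡ n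
sum-fibres {n} f = begin
  sum (λ v → sum (λ i → δ v (f i)))     ≡⟨ ∑-comm (λ v i → δ v (f i)) ⟩
  sum (λ i → sum (λ v → δ v (f i)))     ≡⟨ sum-cong-≗ (λ i → sum-cong-≗ λ v → sym (ℕ.*-identityʳ (δ v (f i)))) ⟩
  sum (λ i → sum (λ v → δ v (f i) * 1)) ≡⟨ sum-cong-≗ (λ i → sum-δ (f i) (λ _ → 1)) ⟩
  sum {n} (λ _ → 1)                     ≡⟨ trans (sum-const n 1) (ℕ.*-identityʳ n) ⟩
  n                                     ∎
  where open ≡-Reasoning

-- The `p` fibres have more than `p * t` points in total, so one has more than `t`; `σ` lists
-- `t + 1` of them.
large-fibre : ∀ {m p} (f : Fin m → Fin p) t → p * t < m →
              ∃[ σ ] Injective {A = Fin (suc t)} _≡_ _≡_ σ × (∀ x y → f (σ x) ≡ f (σ y))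
large-fibre {p = p} f t pt<m =
  let v , t<# = exceeds-mean (λ v → sum (λ i → δ v (f i))) t (subst (p * t <_) (sym (sum-fibres f)) pt<m)
      σ , inj , δ≢0 = select (λ i → δ v (f i)) (λ i → δ≤1 v (f i)) t<#
  in  σ , inj , λ x y → trans (sym (δ≢0⇒≡ v _ (δ≢0 x))) (δ≢0⇒≡ v _ (δ≢0 y))

-- Cauchy-Schwarz for the fibre sizes `#`: their squares add up to the number of ordered pairs with
-- equal values.
sum-agreements-≥ : ∀ {n q} (f : Fin n → Fin q) →
                   n * n ≤ q * sum (λ i → sum (λ i′ → δ (f i) (f i′)))
sum-agreements-≥ {n} {q} f = begin
  n * n                                           ≡⟨ cong₂ _*_ (sum-fibres f) (sum-fibres f) ⟨
  sum # * sum #                                   ≤⟨ cauchy-schwarz # ⟩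
  q * sum (λ v → # v * # v)                       ≡⟨ cong (q *_) squares ⟩
  q * sum (λ i → sum (λ i′ → δ (f i) (f i′)))     ∎
  where
  open ℕ.≤-Reasoning
  # : Fin q → ℕ
  # v = sum (λ i → δ v (f i))
  squares : sum (λ v → # v * # v) ≡ sum (λ i → # (f i))
  squares = begin-equality
    sum (λ v → # v * # v)                       ≡⟨ sum-cong-≗ (λ v → *-distribʳ-sum (# v) (λ i → δ v (f i))) ⟩
    sum (λ v → sum (λ i → δ v (f i) * # v))     ≡⟨ ∑-comm (λ v i → δ v (f i) * # v) ⟩
    sum (λ i → sum (λ v → δ v (f i) * # v))     ≡⟨ sum-cong-≗ (λ i → sum-δ (f i) #) ⟩
    sum (λ i → # (f i))                         ∎

-- The Bose–Bush bound

-- An orthogonal array of strength two and index `r` satisfies `index` with equality. Having a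
-- multiple of `q` columns makes the expected number of agreements of two rows the integer `c`.
module _ {q r t c′ : ℕ} .{{_ : NonZero q}} (u : Fin (suc c′ * q) → Fin (suc t) → Fin q)
  (index : ∀ {j j′} → j′ ≢ j → ∀ i →
    sum (λ i′ → δ (u j i) (u j i′) * δ (u j′ i) (u j′ i′)) ≤ r)
  where

  private
    c k N : ℕ
    c = suc c′
    k = c * q
    N = suc t

    agree : Fin N → Fin N → Fin k → ℕ
    agree i i′ j = δ (u j i) (u j i′)

    a : Fin N → Fin N → ℕ
    a i i′ = sum (agree i i′)

    a-diag : ∀ i → a i i ≡ k
    a-diag i = trans (sum-cong-≗ λ j → δ-refl (u j i)) (trans (sum-const k 1) (ℕ.*-identityʳ k))

    -- Averaging over rows: each column has at least N²/q agreeing pairs, so the `c * q` columns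
    -- together have at least cN².
    rich-row : ∃[ i ] c * N ≤ sum (a i)
    -- As `c * N` is a successor, exceeding its predecessor is the same as reaching `c * N`.
    rich-row = exceeds-mean (λ i → sum (a i)) _ (ℕ.<-≤-trans (ℕ.*-monoʳ-< N (ℕ.n<1+n _)) bound)
      where
      open ℕ.≤-Reasoning
      ring : ∀ c q n → q * (n * (c * n)) ≡ c * q * (n * n)
      ring = solve-∀
      bound : N * (c * N) ≤ sum (λ i → sum (a i))
      bound = ℕ.*-cancelˡ-≤ q (begin
        q * (N * (c * N))                                         ≡⟨ ring c q N ⟩
        k * (N * N)                                               ≡⟨ sum-const k (N * N) ⟨
        sum {k} (λ _ → N * N)                                     ≤⟨ sum-mono-≤ (λ j → sum-agreements-≥ (u j)) ⟩
        sum (λ j → q * sum (λ i → sum (λ i′ → agree i i′ j)))     ≡⟨ *-distribˡ-sum q (λ j → sum (λ i → sum (λ i′ → agree i i′ j))) ⟨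
        q * sum (λ j → sum (λ i → sum (λ i′ → agree i i′ j)))     ≡⟨ cong (q *_) (∑-comm (λ j i → sum (λ i′ → agree i i′ j))) ⟩
        q * sum (λ i → sum (λ j → sum (λ i′ → agree i i′ j)))     ≡⟨ cong (q *_) (sum-cong-≗ λ i → ∑-comm (λ j i′ → agree i i′ j)) ⟩
        q * sum (λ i → sum (a i))                                 ∎)

    -- The square counts ordered pairs of columns in which both rows agree. The diagonal pairs
    -- contribute `sum (a i)`, and each of the k(k - 1) others at most `r` by `index`; the term
    -- `k * r` on the left replaces a subtraction.
    second-moment : ∀ i → sum (λ i′ → a i i′ * a i i′) + k * r ≤ sum (a i) + k * (k * r)
    second-moment i = begin
      sum (λ i′ → a i i′ * a i i′) + k * r
        ≡⟨ cong (_+ k * r) expand ⟩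
      sum (λ j → sum (W j)) + k * r
        ≡⟨ cong (sum (λ j → sum (W j)) +_) (sum-const k r) ⟨
      sum (λ j → sum (W j)) + sum {k} (λ _ → r)
        ≡⟨ ∑-distrib-+ (λ j → sum (W j)) (λ _ → r) ⟨
      sum (λ j → sum (W j) + r)
        ≤⟨ sum-mono-≤ (λ j → sum-mono-except {g = λ _ → r} j λ j′ j′≢j → index j′≢j i) ⟩
      sum (λ j → W j j + sum {k} (λ _ → r))
        ≡⟨ ∑-distrib-+ (λ j → W j j) _ ⟩
      sum (λ j → W j j) + sum {k} (λ _ → sum {k} (λ _ → r))
        ≡⟨ cong₂ _+_ diagonal (trans (sum-const k _) (cong (k *_) (sum-const k r))) ⟩
      sum (a i) + k * (k * r) ∎
      where
      open ℕ.≤-Reasoning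
      W : Fin k → Fin k → ℕ
      W j j′ = sum (λ i′ → agree i i′ j * agree i i′ j′)
      diagonal : sum (λ j → W j j) ≡ sum (a i)
      diagonal = trans (sum-cong-≗ λ j → sum-cong-≗ λ i′ → δ-idem (u j i) (u j i′))
                       (∑-comm (λ j i′ → agree i i′ j))
      expand : sum (λ i′ → a i i′ * a i i′) ≡ sum (λ j → sum (W j))
      expand = begin-equality
        sum (λ i′ → a i i′ * a i i′)
          ≡⟨ sum-cong-≗ (λ i′ → *-distribʳ-sum (a i i′) (agree i i′)) ⟩
        sum (λ i′ → sum (λ j → agree i i′ j * a i i′))
          ≡⟨ ∑-comm (λ i′ j → agree i i′ j * a i i′) ⟩
        sum (λ j → sum (λ i′ → agree i i′ j * a i i′))
          ≡⟨ sum-cong-≗ (λ j → sum-cong-≗ λ i′ → *-distribˡ-sum (agree i i′ j) (agree i i′)) ⟩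
        sum (λ j → sum (λ i′ → sum (λ j′ → agree i i′ j * agree i i′ j′)))
          ≡⟨ sum-cong-≗ (λ j → ∑-comm (λ i′ j′ → agree i i′ j * agree i i′ j′)) ⟩
        sum (λ j → sum (W j)) ∎

    -- Σ (a i i′ - c)² over i′, bounded below by its term at i′ = i; c = k / q is the
    -- value of a i i′ expected of random words.
    variance : ∀ i → 2 * c * sum (a i) + (k * k + c * c) ≤
                     2 * c * k + (sum (λ i′ → a i i′ * a i i′) + N * (c * c))
    variance i = begin
      2 * c * sum (a i) + (k * k + c * c)
        ≡⟨ cong₂ _+_ (*-distribˡ-sum (2 * c) (a i)) (cong (λ x → x * x + c * c) (sym (a-diag i))) ⟩
      sum (λ i′ → 2 * c * a i i′) + (a i i * a i i + c * c)
        ≤⟨ sum-mono-except {g = λ i′ → a i i′ * a i i′ + c * c} i (λ i′ _ → am-gm (a i i′)) ⟩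
      2 * c * a i i + sum (λ i′ → a i i′ * a i i′ + c * c)
        ≡⟨ cong₂ _+_ (cong (2 * c *_) (a-diag i)) (∑-distrib-+ (λ i′ → a i i′ * a i i′) (λ _ → c * c)) ⟩
      2 * c * k + (sum (λ i′ → a i i′ * a i i′) + sum {N} (λ _ → c * c))
        ≡⟨ cong (λ x → 2 * c * k + (sum (λ i′ → a i i′ * a i i′) + x)) (sum-const N (c * c)) ⟩
      2 * c * k + (sum (λ i′ → a i i′ * a i i′) + N * (c * c)) ∎
      where
      open ℕ.≤-Reasoning
      ring : ∀ c x → 2 * c * x ≡ 2 * (x * c)
      ring = solve-∀
      am-gm : ∀ x → 2 * c * x ≤ x * x + c * c
      am-gm x = subst (_≤ x * x + c * c) (sym (ring c x)) (2*≤²+² x c)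

  -- Adding `variance` and `second-moment` for a rich row cancels `A` and leaves `T` with the
  -- positive coefficient 2c - 1, so `T` may be replaced by its lower bound `c * N`; then a factor
  -- `c` cancels.
  bose-bush : c′ * N + c * (q * q) + c + q * r ≤ 2 * (c * q) + c * (q * q) * r
  bose-bush with rich-row
  ... | i , cN≤T = ℕ.*-cancelˡ-≤ c (ℕ.+-cancelʳ-≤ (T + A + N * (c * c)) _ _ (begin
    c * (c′ * N + c * (q * q) + c + q * r) + (T + A + N * (c * c))
      ≡⟨ ring₁ c′ N q r T A ⟩
    T + (1 + 2 * c′) * (c * N) + (k * k + c * c) + (A + k * r)
      ≤⟨ ℕ.+-monoˡ-≤ (A + k * r) (ℕ.+-monoˡ-≤ (k * k + c * c) (ℕ.+-monoʳ-≤ T (ℕ.*-monoʳ-≤ (1 + 2 * c′) cN≤T))) ⟩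
    T + (1 + 2 * c′) * T + (k * k + c * c) + (A + k * r)
      ≡⟨ ring₂ c′ N q r T A ⟩
    2 * c * T + (k * k + c * c) + (A + k * r)
      ≤⟨ ℕ.+-mono-≤ (variance i) (second-moment i) ⟩
    2 * c * k + (A + N * (c * c)) + (T + k * (k * r))
      ≡⟨ ring₃ c N q r T A ⟩
    c * (2 * (c * q) + c * (q * q) * r) + (T + A + N * (c * c)) ∎))
    where
    open ℕ.≤-Reasoning
    T = sum (a i)
    A = sum (λ i′ → a i i′ * a i i′)
    ring₁ : ∀ c′ N q r T A → let c = 1 + c′ ; k = c * q in
      c * (c′ * N + c * (q * q) + c + q * r) + (T + A + N * (c * c)) ≡
      T + (1 + 2 * c′) * (c * N) + (k * k + c * c) + (A + k * r)
    ring₁ = solve-∀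
    ring₂ : ∀ c′ N q r T A → let c = 1 + c′ ; k = c * q in
      T + (1 + 2 * c′) * T + (k * k + c * c) + (A + k * r) ≡
      2 * c * T + (k * k + c * c) + (A + k * r)
    ring₂ = solve-∀
    ring₃ : ∀ c N q r T A → let k = c * q in
      2 * c * k + (A + N * (c * c)) + (T + k * (k * r)) ≡
      c * (2 * (c * q) + c * (q * q) * r) + (T + A + N * (c * c))
    ring₃ = solve-∀

-- Row colours in grids

funToFin-injective : ∀ {m n} (f g : Fin m → Fin n) → funToFin f ≡ funToFin g → f ≗ g
funToFin-injective f g e x = begin
  f x                        ≡⟨ Fin.finToFun-funToFin f x ⟨
  finToFun (funToFin f) x    ≡⟨ cong (λ k → finToFun k x) e ⟩
  finToFun (funToFin g) x    ≡⟨ Fin.finToFun-funToFin g x ⟩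
  g x                        ∎
  where open ≡-Reasoning

[1+n]C2 : ∀ n → suc n C 2 ≡ n + n C 2
[1+n]C2 n = trans (sym (nCk+nC[k+1]≡[n+1]C[k+1] n 1)) (cong (_+ n C 2) (nC1≡n n))

^-[1+n]C2 : ∀ r n → r ^ n * r ^ (n C 2) ≡ r ^ (suc n C 2)
^-[1+n]C2 r n = trans (sym (ℕ.^-distribˡ-+-* r n (n C 2))) (cong (r ^_) (sym ([1+n]C2 n)))

-- Only the entries above the diagonal are recorded, row by row, which keeps the number of codes at
-- exactly one per colouring of the pairs.
pairCode : ∀ {r} n → (Fin n → Fin n → Fin r) → Fin (r ^ (n C 2))
pairCode         zero    h = zero
pairCode {r = r} (suc n) h = subst Fin (^-[1+n]C2 r n)
  (combine (funToFin (h zero ∘ suc)) (pairCode n λ x y → h (suc x) (suc y)))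

pairCode-injective : ∀ {r} n (h h′ : Fin n → Fin n → Fin r) → pairCode n h ≡ pairCode n h′ →
                     ∀ x y → x Fin.< y → h x y ≡ h′ x y
pairCode-injective {r} (suc n) h h′ e = λ
  { zero    (suc y) _   → funToFin-injective (h zero ∘ suc) (h′ zero ∘ suc) (proj₁ parts) y
  ; (suc x) (suc y) x<y → pairCode-injective n (rest h) (rest h′) (proj₂ parts) x y (s≤s⁻¹ x<y)
  }
  where
  rest : (Fin (suc n) → Fin (suc n) → Fin r) → Fin n → Fin n → Fin r
  rest h x y = h (suc x) (suc y)
  parts = Fin.combine-injective (funToFin (h zero ∘ suc)) (pairCode n (rest h))
            (funToFin (h′ zero ∘ suc)) (pairCode n (rest h′)) (subst-injective (^-[1+n]C2 r n) e)

-- The only consequence of avoiding alternating rectangles that the counting uses; it no longer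
-- mentions edges inside columns. Since `d` may be any injection, columns can be listed in a
-- convenient order.
Separated : ∀ {m n r} → (Fin m → Fin n → Fin n → Fin r) → Set
Separated {m} {n} {r} ρ =
  ∀ {i i′} → i ≢ i′ → (d : Fin (suc r) → Fin n) → Injective _≡_ _≡_ d →
  ¬ (∀ x y → x Fin.< y → ρ i (d x) (d y) ≡ ρ i′ (d x) (d y))

separated⇒≤ : ∀ {m n r} (ρ : Fin m → Fin n → Fin n → Fin r) → Separated ρ → suc r ≤ n →
              m ≤ r ^ (suc r C 2)
separated⇒≤ {r = r} ρ sep r<n = ℕ.≮⇒≥ λ few →
  let i , i′ , i<i′ , same = Fin.pigeonhole few (λ i → pairCode (suc r) (λ x y → ρ i (d x) (d y)))
  in  sep (Fin.<⇒≢ i<i′) d (Fin.inject≤-injective r<n r<n _ _) (pairCode-injective (suc r) _ _ same)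
  where
  d : Fin (suc r) → Fin _
  d x = inject≤ x r<n

-- Rows alike on the base as an array of words

module _ {m n p c′ t : ℕ}
  (ρ : Fin m → Fin n → Fin n → Fin (suc p)) (sep : Separated ρ)
  (wide : p + suc c′ * suc p ^ p ≤ n) (tall : suc p ^ (p C 2) * t < m)
  where

  private
    r q k : ℕ
    r = suc p
    q = r ^ p
    k = suc c′ * q

    column : Fin (p + k) → Fin n
    column x = inject≤ x wide

    base : Fin p → Fin n
    base b = column (b ↑ˡ k)

    other : Fin k → Fin n
    other j = column (p ↑ʳ j)

    column-injective : ∀ {x y} → column x ≡ column y → x ≡ y
    column-injective = Fin.inject≤-injective wide wide _ _

    base≢other : ∀ {b j} → base b ≢ other j
    base≢other {b} {j} e with () ← trans (sym (Fin.splitAt-↑ˡ p b k))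
      (trans (cong (Fin.splitAt p) (column-injective e)) (Fin.splitAt-↑ʳ p k j))

    -- With the two further columns listed first, the pairs `x < y` split into the pair of further
    -- columns, the letters of their two words, and the pairs inside the base.
    columns : Fin k → Fin k → Fin (suc r) → Fin n
    columns j j′ zero          = other j
    columns j j′ (suc zero)    = other j′
    columns j j′ (suc (suc b)) = base b

    columns-injective : ∀ {j j′} → j′ ≢ j → Injective _≡_ _≡_ (columns j j′)
    columns-injective ≢ {zero}        {zero}        e = refl
    columns-injective ≢ {zero}        {suc zero}    e =
      contradiction (sym (Fin.↑ʳ-injective p _ _ (column-injective e))) ≢
    columns-injective ≢ {zero}        {suc (suc y)} e = contradiction (sym e) base≢other
    columns-injective ≢ {suc zero}    {zero}        e =
      contradiction (Fin.↑ʳ-injective p _ _ (column-injective e)) ≢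
    columns-injective ≢ {suc zero}    {suc zero}    e = refl
    columns-injective ≢ {suc zero}    {suc (suc y)} e = contradiction (sym e) base≢other
    columns-injective ≢ {suc (suc x)} {zero}        e = contradiction e base≢other
    columns-injective ≢ {suc (suc x)} {suc zero}    e = contradiction e base≢other
    columns-injective ≢ {suc (suc x)} {suc (suc y)} e =
      cong (λ b → suc (suc b)) (Fin.↑ˡ-injective k _ _ (column-injective e))

    baseCode : Fin m → Fin (r ^ (p C 2))
    baseCode i = pairCode p (λ b b′ → ρ i (base b) (base b′))

    row : Fin (suc t) → Fin m
    row = proj₁ (large-fibre baseCode t tall)

    row-injective : Injective _≡_ _≡_ row
    row-injective = proj₁ (proj₂ (large-fibre baseCode t tall))

    row-baseCode : ∀ i i′ → baseCode (row i) ≡ baseCode (row i′)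
    row-baseCode = proj₂ (proj₂ (large-fibre baseCode t tall))

    u : Fin k → Fin (suc t) → Fin q
    u j i = funToFin (λ b → ρ (row i) (other j) (base b))

    -- The rows agree inside the base by choice of `row`, between the base and `j`, `j′` by equality
    -- of words, and between `j` and `j′` by the last hypothesis. These are all pairs from `r + 1`
    -- columns.
    agreement⇒≡ : ∀ {i i′ j j′} → j′ ≢ j → u j i ≡ u j i′ → u j′ i ≡ u j′ i′ →
                  ρ (row i) (other j) (other j′) ≡ ρ (row i′) (other j) (other j′) → i ≡ i′
    agreement⇒≡ {i} {i′} {j} {j′} j′≢j uj uj′ e with i Fin.≟ i′
    ... | yes i≡i′ = i≡i′
    ... | no  i≢i′ = contradiction agree (sep (i≢i′ ∘ row-injective) (columns j j′) (columns-injective j′≢j))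
      where
      agree : ∀ x y → x Fin.< y →
        ρ (row i) (columns j j′ x) (columns j j′ y) ≡ ρ (row i′) (columns j j′ x) (columns j j′ y)
      agree zero          (suc zero)    _ = e
      agree zero          (suc (suc y)) _ = funToFin-injective _ _ uj y
      agree (suc zero)    (suc (suc y)) _ = funToFin-injective _ _ uj′ y
      agree (suc (suc x)) (suc (suc y)) (s≤s (s≤s x<y)) =
        pairCode-injective p _ _ (row-baseCode i i′) x y x<y
      agree (suc zero)    (suc zero)    (s≤s ())

    index : ∀ {j j′} → j′ ≢ j → ∀ i →
            sum (λ i′ → δ (u j i) (u j i′) * δ (u j′ i) (u j′ i′)) ≤ r
    index {j} {j′} j′≢j i = ℕ.≮⇒≥ λ many →
      let τ , τ-injective , w≢0 = select w w≤1 many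
          -- Among `r + 1` rows sharing both words with `i`, two have the same one of the `r`
          -- colours between `j` and `j′`.
          x , y , x<y , e = Fin.pigeonhole ℕ.≤-refl (λ x → ρ (row (τ x)) (other j) (other j′))
          uj  x = δ≢0⇒≡ (u j i) (u j (τ x)) (λ e → w≢0 x (cong (_* δ (u j′ i) (u j′ (τ x))) e))
          uj′ x = δ≢0⇒≡ (u j′ i) (u j′ (τ x))
                    (λ e → w≢0 x (trans (cong (δ (u j i) (u j (τ x)) *_) e) (ℕ.*-zeroʳ (δ (u j i) (u j (τ x))))))
      in  Fin.<⇒≢ x<y (τ-injective
            (agreement⇒≡ j′≢j (trans (sym (uj x)) (uj y)) (trans (sym (uj′ x)) (uj′ y)) e))
      where
      w : Fin (suc t) → ℕ
      w i′ = δ (u j i) (u j i′) * δ (u j′ i) (u j′ i′)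
      w≤1 : ∀ i′ → w i′ ≤ 1
      w≤1 i′ = ℕ.*-mono-≤ (δ≤1 (u j i) (u j i′)) (δ≤1 (u j′ i) (u j′ i′))

  separated-bound : c′ * suc t + suc c′ * (q * q) + suc c′ + q * r ≤
                    2 * (suc c′ * q) + suc c′ * (q * q) * r
  separated-bound = bose-bush {t = t} {c′} {{ℕ.m^n≢0 r p}} u index

-- From colourings to row colours

module _ {m n p} (c : Colouring m n (suc p)) where

  -- Using `total` removes the adjacency proofs. Its default colour at `j = j′` does no harm, as
  -- `Separated` compares only distinct columns.
  rowColour : Fin m → Fin n → Fin n → Fin (suc p)
  rowColour i j j′ = total c (i , j) (i , j′)

  alternating : ∀ {i i′ j j′} → i Fin.< i′ → j Fin.< j′ →
    total c (i , j) (i′ , j) ≡ total c (i , j′) (i′ , j′) →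
    rowColour i j j′ ≡ rowColour i′ j j′ → HasAlternating c
  alternating {i} {i′} {j} {j′} i<i′ j<j′ e e′ =
    i , i′ , i<i′ , j , j′ , j<j′ ,
    subst₂ _≡_ (total-adjacent c _ _ (sameColumn (Fin.<⇒≢ i<i′)))
               (total-adjacent c _ _ (sameColumn (Fin.<⇒≢ i<i′))) e ,
    subst₂ _≡_ (total-adjacent c _ _ (sameRow (Fin.<⇒≢ j<j′)))
               (total-adjacent c _ _ (sameRow (Fin.<⇒≢ j<j′))) e′

  -- Columns picked through an injection come in either order; if they are reversed, the symmetry of
  -- edges gives the same rectangle.
  alternating-≢ : ∀ {i i′ j j′} → i Fin.< i′ → j ≢ j′ →
    total c (i , j) (i′ , j) ≡ total c (i , j′) (i′ , j′) →
    rowColour i j j′ ≡ rowColour i′ j j′ → HasAlternating c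
  alternating-≢ {i} {i′} {j} {j′} i<i′ j≢j′ e e′ with Fin.<-cmp j j′
  ... | tri< j<j′ _ _ = alternating i<i′ j<j′ e e′
  ... | tri≈ _ j≡j′ _ = contradiction j≡j′ j≢j′
  ... | tri> _ _ j′<j = alternating i<i′ j′<j (sym e)
                          (trans (total-sym c (i , j′) (i , j)) (trans e′ (total-sym c (i′ , j) (i′ , j′))))

  nonalternating⇒separated : ¬ HasAlternating c → Separated rowColour
  nonalternating⇒separated ¬alt {i} {i′} i≢i′ d inj agree with Fin.<-cmp i i′
  ... | tri≈ _ i≡i′ _ = i≢i′ i≡i′
  ... | tri< i<i′ _ _ =
    -- One edge between the two rows inside each of the `r + 1` chosen columns, but only `r`
    -- colours.
    let x , y , x<y , e = Fin.pigeonhole ℕ.≤-refl (λ x → total c (i , d x) (i′ , d x))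
    in  ¬alt (alternating-≢ i<i′ (Fin.<⇒≢ x<y ∘ inj) e (agree x y x<y))
  ... | tri> _ _ i′<i =
    let x , y , x<y , e = Fin.pigeonhole ℕ.≤-refl (λ x → total c (i′ , d x) (i , d x))
    in  ¬alt (alternating-≢ i′<i (Fin.<⇒≢ x<y ∘ inj) e (sym (agree x y x<y)))

avoidable-mono : ∀ {m n k r} → k ≤ r → Avoidable m n k → Avoidable m n r
avoidable-mono k≤r (c , ¬alt) =
  record { colour    = λ u v a → inject≤ (colour c u v a) k≤r
         ; symmetric = λ u v a → cong (λ x → inject≤ x k≤r) (symmetric c u v a) } ,
  λ (i , i′ , i<i′ , j , j′ , j<j′ , e , e′) →
    ¬alt (i , i′ , i<i′ , j , j′ , j<j′ , Fin.inject≤-injective k≤r k≤r _ _ e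
                                        , Fin.inject≤-injective k≤r k≤r _ _ e′)

-- Numerical estimates

rowCount columnCount : ℕ → ℕ
rowCount    r = r ^ ((r + 1) C 2) ∸ (r / 4) * r ^ (r C 2) + 1
columnCount r = ⌈ r ^ ((r + 1) C 2) /2⌉

2*m≤n⇒m≤⌈n/2⌉ : ∀ {m n} → 2 * m ≤ n → m ≤ ⌈ n /2⌉
2*m≤n⇒m≤⌈n/2⌉ {m} {n} 2m≤n = begin
  m             ≡⟨ ℕ.n≡⌈n+n/2⌉ m ⟩
  ⌈ m + m /2⌉   ≤⟨ ℕ.⌈n/2⌉-mono (subst (_≤ n) (cong (_+_ m) (ℕ.+-identityʳ m)) 2m≤n) ⟩
  ⌈ n /2⌉       ∎
  where open ℕ.≤-Reasoning

2*m≤n⇒m≤⌊n/2⌋ : ∀ {m n} → 2 * m ≤ n → m ≤ ⌊ n /2⌋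
2*m≤n⇒m≤⌊n/2⌋ {m} {n} 2m≤n = begin
  m             ≡⟨ ℕ.n≡⌊n+n/2⌋ m ⟩
  ⌊ m + m /2⌋   ≤⟨ ℕ.⌊n/2⌋-mono (subst (_≤ n) (cong (_+_ m) (ℕ.+-identityʳ m)) 2m≤n) ⟩
  ⌊ n /2⌋       ∎
  where open ℕ.≤-Reasoning

module _ (p : ℕ) where

  private
    r q P s : ℕ
    r = suc p
    q = r ^ p
    P = r ^ (p C 2)
    s = r / 4

    1≤q : 1 ≤ q
    1≤q = ℕ.m^n>0 r p

    1≤P : 1 ≤ P
    1≤P = ℕ.m^n>0 r (p C 2)

  r^rC2 : r ^ (r C 2) ≡ q * P
  r^rC2 = sym (^-[1+n]C2 r p)

  r^[r+1]C2 : r ^ ((r + 1) C 2) ≡ r * q * (q * P)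
  r^[r+1]C2 = begin
    r ^ ((r + 1) C 2)          ≡⟨ cong (λ x → r ^ (x C 2)) (ℕ.+-comm r 1) ⟩
    r ^ (suc r C 2)            ≡⟨ ^-[1+n]C2 r r ⟨
    r * q * r ^ (r C 2)        ≡⟨ cong (r * q *_) r^rC2 ⟩
    r * q * (q * P)            ∎
    where open ≡-Reasoning

  -- Follows from 2s ≤ 4s ≤ r. It makes the subtraction in `rowCount` exact and leaves at least half
  -- of the power.
  2*deficiency≤ : 2 * (s * r ^ (r C 2)) ≤ r ^ ((r + 1) C 2)
  2*deficiency≤ = begin
    2 * (s * r ^ (r C 2)) ≡⟨ cong (λ x → 2 * (s * x)) r^rC2 ⟩
    2 * (s * (q * P))     ≡⟨ ring s (q * P) ⟩
    s * 2 * (q * P)       ≤⟨ ℕ.*-monoˡ-≤ (q * P) (begin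
        s * 2 ≤⟨ ℕ.*-monoʳ-≤ s (s≤s (s≤s (z≤n {2}))) ⟩
        s * 4 ≤⟨ m/n*n≤m r 4 ⟩
        r     ≡⟨ ℕ.*-identityʳ r ⟨
        r * 1 ≤⟨ ℕ.*-monoʳ-≤ r 1≤q ⟩
        r * q ∎) ⟩
    r * q * (q * P)       ≡⟨ r^[r+1]C2 ⟨
    r ^ ((r + 1) C 2)     ∎
    where
    open ℕ.≤-Reasoning
    ring : ∀ s x → 2 * (s * x) ≡ s * 2 * x
    ring = solve-∀

  -- For the bound on `G`: the square grid with `rowCount r` rows is then wide enough.
  columnCount≤rowCount : columnCount r ≤ rowCount r
  columnCount≤rowCount = begin
    ⌈ X /2⌉                            ≡⟨ ℕ.m+n∸m≡n ⌊ X /2⌋ ⌈ X /2⌉ ⟨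
    ⌊ X /2⌋ + ⌈ X /2⌉ ∸ ⌊ X /2⌋        ≡⟨ cong (_∸ ⌊ X /2⌋) (ℕ.⌊n/2⌋+⌈n/2⌉≡n X) ⟩
    X ∸ ⌊ X /2⌋                        ≤⟨ ℕ.∸-monoʳ-≤ X (2*m≤n⇒m≤⌊n/2⌋ {s * r ^ (r C 2)} 2*deficiency≤) ⟩
    X ∸ s * r ^ (r C 2)                ≤⟨ ℕ.m≤m+n _ 1 ⟩
    rowCount r                         ∎
    where
    open ℕ.≤-Reasoning
    X = r ^ ((r + 1) C 2)

  module _ (4≤r : 4 ≤ r) where

    private
      r³≤q : r * (r * (r * 1)) ≤ q
      r³≤q = ℕ.^-monoʳ-≤ r (s≤s⁻¹ 4≤r)

      6≤q : 6 ≤ q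
      6≤q = begin
        6                 ≤⟨ ℕ.m≤m+n 6 58 ⟩
        4 * (4 * (4 * 1)) ≤⟨ ℕ.*-mono-≤ 4≤r (ℕ.*-mono-≤ 4≤r (ℕ.*-monoˡ-≤ 1 4≤r)) ⟩
        r * (r * (r * 1)) ≤⟨ r³≤q ⟩
        q                 ∎
        where open ℕ.≤-Reasoning

    -- Room for the base and for `c * q` further columns with `c = r + 1`: twice their number is at
    -- most 6rq, and `6 ≤ q`.
    wide-enough : p + suc r * q ≤ columnCount r
    wide-enough = 2*m≤n⇒m≤⌈n/2⌉ (begin
      2 * (p + suc r * q)             ≤⟨ ℕ.*-monoʳ-≤ 2 (ℕ.+-mono-≤ p≤rq (ℕ.+-monoˡ-≤ (r * q) (ℕ.m≤m+n q (p * q)))) ⟩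
      2 * (r * q + (r * q + r * q))   ≡⟨ ring (r * q) ⟩
      r * q * 6                       ≤⟨ ℕ.*-monoʳ-≤ (r * q) 6≤q ⟩
      r * q * q                       ≤⟨ ℕ.*-monoʳ-≤ (r * q) (ℕ.m≤m*n q P {{>-nonZero 1≤P}}) ⟩
      r * q * (q * P)                 ≡⟨ r^[r+1]C2 ⟨
      r ^ ((r + 1) C 2)               ∎)
      where
      open ℕ.≤-Reasoning
      p≤rq : p ≤ r * q
      p≤rq = ℕ.≤-trans (ℕ.n≤1+n p) (ℕ.m≤m*n r q {{>-nonZero 1≤q}})
      ring : ∀ x → 2 * (x + (x + x)) ≡ x * 6
      ring = solve-∀

    -- Chosen so that `P * t + 1` is exactly `rowCount r`; pigeonhole over the `P` base patterns
    -- then leaves `t + 1` rows.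
    t : ℕ
    t = r * (q * q) ∸ s * q

    tall-enough : P * t < rowCount r
    tall-enough = ℕ.≤-reflexive (begin
      suc (P * t)                                  ≡⟨ ℕ.+-comm 1 (P * t) ⟩
      P * t + 1                                    ≡⟨ cong (_+ 1) (ℕ.*-distribˡ-∸ P _ _) ⟩
      P * (r * (q * q)) ∸ P * (s * q) + 1          ≡⟨ cong₂ (λ x y → x ∸ y + 1) (ring₁ r q P) (ring₂ s q P) ⟩
      r * q * (q * P) ∸ s * (q * P) + 1            ≡⟨ cong₂ (λ x y → x ∸ s * y + 1) r^[r+1]C2 r^rC2 ⟨
      rowCount r                                   ∎)
      where
      open ≡-Reasoning
      ring₁ : ∀ r q P → P * (r * (q * q)) ≡ r * q * (q * P)
      ring₁ = solve-∀
      ring₂ : ∀ s q P → P * (s * q) ≡ s * (q * P)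
      ring₂ = solve-∀

    -- This is the bound with `c′ = r`. The terms r²q², rq² and qr cancel, leaving q² ≤ (rs + r +
    -- 2)q. But rs + r + 2 < 2r² ≤ r³ ≤ q, where the last step uses that the exponent `p` of `q` is
    -- at least 3.
    too-many-rows : ¬ (r * suc t + suc r * (q * q) + suc r + q * r ≤ 2 * (suc r * q) + suc r * (q * q) * r)
    too-many-rows bound = ℕ.<⇒≱ small (ℕ.+-cancelˡ-≤ (r * (r * (q * q)) + r * (q * q) + q * r) _ _ (begin
      D + q * r + q * q                                      ≤⟨ ℕ.m≤m+n _ (r + suc r) ⟩
      D + q * r + q * q + (r + suc r)                        ≤⟨ ℕ.+-monoˡ-≤ (r + suc r) (ℕ.+-monoˡ-≤ (q * q) (ℕ.+-monoˡ-≤ (q * r) (ℕ.+-monoˡ-≤ (r * (q * q)) (ℕ.*-monoʳ-≤ r (ℕ.m≤n+m∸n (r * (q * q)) (s * q))))))⟩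
      r * (s * q + t) + r * (q * q) + q * r + q * q + (r + suc r)
                                                             ≡⟨ ring₁ r s q t ⟩
      r * (s * q) + (r * suc t + suc r * (q * q) + suc r + q * r) ≤⟨ ℕ.+-monoʳ-≤ (r * (s * q)) bound ⟩
      r * (s * q) + (2 * (suc r * q) + suc r * (q * q) * r)  ≡⟨ ring₂ r s q ⟩
      D + q * r + (r * s + 2 + r) * q ∎))
      where
      open ℕ.≤-Reasoning
      D = r * (r * (q * q)) + r * (q * q)
      ring₁ : ∀ r s q t → r * (s * q + t) + r * (q * q) + q * r + q * q + (r + (1 + r)) ≡
                          r * (s * q) + (r * (1 + t) + (1 + r) * (q * q) + (1 + r) + q * r)
      ring₁ = solve-∀
      ring₂ : ∀ r s q → r * (s * q) + (2 * ((1 + r) * q) + (1 + r) * (q * q) * r) ≡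
                        r * (r * (q * q)) + r * (q * q) + q * r + (r * s + 2 + r) * q
      ring₂ = solve-∀
      small : (r * s + 2 + r) * q < q * q
      small = ℕ.*-monoˡ-< q {{>-nonZero 1≤q}} (begin-strict
        r * s + 2 + r         ≤⟨ ℕ.+-monoˡ-≤ r (ℕ.+-mono-≤ (ℕ.*-monoʳ-≤ r (m/n≤m r 4)) (ℕ.≤-trans (ℕ.m≤m+n 2 2) 4≤r)) ⟩
        r * r + r + r         <⟨ ℕ.m<m+n _ (ℕ.≤-trans (s≤s z≤n) 4≤r) ⟩
        r * r + r + r + r     ≡⟨ ring₃ r ⟩
        r * r + r * 3         ≤⟨ ℕ.+-monoʳ-≤ (r * r) (ℕ.*-monoʳ-≤ r (ℕ.≤-trans (ℕ.n≤1+n 3) 4≤r)) ⟩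
        r * r + r * r         ≡⟨ ring₄ r ⟩
        r * (r * 2)           ≤⟨ ℕ.*-monoʳ-≤ r (ℕ.*-monoʳ-≤ r (ℕ.≤-trans (ℕ.m≤m+n 2 2) 4≤r)) ⟩
        r * (r * r)           ≡⟨ cong (λ x → r * (r * x)) (ℕ.*-identityʳ r) ⟨
        r * (r * (r * 1))     ≤⟨ r³≤q ⟩
        q                     ∎)
        where
        ring₃ : ∀ r → r * r + r + r + r ≡ r * r + r * 3
        ring₃ = solve-∀
        ring₄ : ∀ r → r * r + r * r ≡ r * (r * 2)
        ring₄ = solve-∀

-- The bounds on g and G

¬avoidable : ∀ r → r ≥ 2 → ∀ {n} → columnCount r ≤ n → ¬ Avoidable (rowCount r) n r
¬avoidable 1 (s≤s ())
-- columnCount 2 = 4 and columnCount 3 = 365.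
¬avoidable 2 _ wide (c , ¬alt) = ℕ.1+n≰n (separated⇒≤ (rowColour c)
  (nonalternating⇒separated c ¬alt) (ℕ.≤-trans (ℕ.m≤m+n 3 1) wide))
¬avoidable 3 _ wide (c , ¬alt) = ℕ.1+n≰n (separated⇒≤ (rowColour c)
  (nonalternating⇒separated c ¬alt) (ℕ.≤-trans (ℕ.m≤m+n 4 361) wide))
¬avoidable (suc p@(suc (suc (suc _)))) _ wide (c , ¬alt) = too-many-rows p 4≤r
  (separated-bound (rowColour c) (nonalternating⇒separated c ¬alt)
    (ℕ.≤-trans (wide-enough p 4≤r) wide) (tall-enough p 4≤r))
  where
  4≤r : 4 ≤ suc p
  4≤r = s≤s (s≤s (s≤s (s≤s z≤n)))

-- The minimum is attained, so a value at most `r` would give an `r`-colouring by `avoidable-mono`.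
g-bound : ∀ r → r ≥ 2 → g (rowCount r) (columnCount r) ≥ r + 1
g-bound r r≥2 = ℕ.≮⇒≥ λ g<r+1 → ¬avoidable r r≥2 ℕ.≤-refl
  (avoidable-mono (s≤s⁻¹ (subst (g (rowCount r) (columnCount r) <_) (ℕ.+-comm r 1) g<r+1)) (proj₁ (g-isLeast (rowCount r) (columnCount r))))

G≤rowCount : ∀ r → r ≥ 2 → G r ≤ rowCount r
G≤rowCount r@(suc p) r≥2 = proj₂ (G-isLeast r) (rowCount r) λ c →
  decidable-stable (hasAlternating? c) λ ¬alt → ¬avoidable r r≥2 (columnCount≤rowCount p) (c , ¬alt)

-- Imported only here, as +_ makes sections of the addition of ℕ ambiguous.
open import Data.Integer as ℤ using (+_; -[1+_]; +<+; +≤+)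

-- The asymptotic bound over the rationals

fromℕᵘ : ∀ n → toℚᵘ (fromℕ n) ℚᵘ.≃ mkℚᵘ (+ n) 0
fromℕᵘ n = ℚ.toℚᵘ-fromℚᵘ (mkℚᵘ (+ n) 0)

fromℕ-mono-≤ : ∀ {m n} → m ≤ n → fromℕ m ℚ.≤ fromℕ n
fromℕ-mono-≤ {m} {n} m≤n = ℚ.toℚᵘ-cancel-≤
  (ℚᵘ.≤-respˡ-≃ (ℚᵘ.≃-sym (fromℕᵘ m)) (ℚᵘ.≤-respʳ-≃ (ℚᵘ.≃-sym (fromℕᵘ n))
    (*≤* (ℤ.*-monoʳ-≤-nonNeg (+ 1) (+≤+ m≤n)))))

fromℕ-homo-+ : ∀ m n → fromℕ (m + n) ≡ fromℕ m ℚ.+ fromℕ n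
fromℕ-homo-+ m n = ℚ.toℚᵘ-injective (begin
  toℚᵘ (fromℕ (m + n))                    ≈⟨ fromℕᵘ (m + n) ⟩
  mkℚᵘ (+ (m + n)) 0                      ≈⟨ *≡* (cong (ℤ._* + 1) (sym (cong₂ ℤ._+_ (ℤ.*-identityʳ (+ m)) (ℤ.*-identityʳ (+ n))))) ⟩
  mkℚᵘ (+ m) 0 ℚᵘ.+ mkℚᵘ (+ n) 0          ≈⟨ ℚᵘ.+-cong (fromℕᵘ m) (fromℕᵘ n) ⟨
  toℚᵘ (fromℕ m) ℚᵘ.+ toℚᵘ (fromℕ n)      ≈⟨ ℚ.toℚᵘ-homo-+ (fromℕ m) (fromℕ n) ⟨
  toℚᵘ (fromℕ m ℚ.+ fromℕ n)              ∎)
  where open ℚᵘ.≃-Reasoning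

fromℕ-homo-* : ∀ m n → fromℕ (m * n) ≡ fromℕ m ℚ.* fromℕ n
fromℕ-homo-* m n = ℚ.toℚᵘ-injective (begin
  toℚᵘ (fromℕ (m * n))                    ≈⟨ fromℕᵘ (m * n) ⟩
  mkℚᵘ (+ (m * n)) 0                      ≈⟨ *≡* (cong (ℤ._* + 1) (ℤ.pos-* m n)) ⟩
  mkℚᵘ (+ m) 0 ℚᵘ.* mkℚᵘ (+ n) 0          ≈⟨ ℚᵘ.*-cong (fromℕᵘ m) (fromℕᵘ n) ⟨
  toℚᵘ (fromℕ m) ℚᵘ.* toℚᵘ (fromℕ n)      ≈⟨ ℚ.toℚᵘ-homo-* (fromℕ m) (fromℕ n) ⟨
  toℚᵘ (fromℕ m ℚ.* fromℕ n)              ∎)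
  where open ℚᵘ.≃-Reasoning

-- The error `8 * r ^ (r C 2)` of `G-bound`, divided by 4, is 2/r times `r * r ^ (r C 2)`. The value
-- at zero is arbitrary.
ε : ℕ → ℚ
ε zero    = 0ℚ
ε (suc n) = + 2 ℚ./ suc n

ε*r≡2 : ∀ n → ε (suc n) ℚ.* fromℕ (suc n) ≡ fromℕ 2
ε*r≡2 n = ℚ.toℚᵘ-injective (begin
  toℚᵘ (ε (suc n) ℚ.* fromℕ (suc n))             ≈⟨ ℚ.toℚᵘ-homo-* (ε (suc n)) (fromℕ (suc n)) ⟩
  toℚᵘ (ε (suc n)) ℚᵘ.* toℚᵘ (fromℕ (suc n))     ≈⟨ ℚᵘ.*-cong (ℚ.toℚᵘ-fromℚᵘ (mkℚᵘ (+ 2) n)) (fromℕᵘ (suc n)) ⟩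
  mkℚᵘ (+ 2) n ℚᵘ.* mkℚᵘ (+ suc n) 0             ≈⟨ *≡* (trans (ℤ.*-identityʳ _) (cong (+ 2 ℤ.*_) (cong +_ (sym (ℕ.*-identityʳ (suc n)))))) ⟩
  mkℚᵘ (+ 2) 0                                   ≈⟨ fromℕᵘ 2 ⟨
  toℚᵘ (fromℕ 2)                                 ∎)
  where open ℚᵘ.≃-Reasoning

ε→0 : TendsToZero ε
ε→0 (mkℚ (+ zero)  d _) (*<* (+<+ ()))
ε→0 (mkℚ (-[1+ _ ]) d _) (*<* ())
-- Here δ is (a + 1)/(d + 1), and r > 2(d + 1) gives 2/r < 1/(d + 1) ≤ δ.
ε→0 δ@(mkℚ (+ suc a) d _) _ = suc (2 * suc d) , small
  where
  small : ∀ r → suc (2 * suc d) ≤ r → ℚ.∣ ε r ∣ ℚ.< δ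
  small (suc n) 2[1+d]<1+n = ℚ.toℚᵘ-cancel-< (ℚᵘ.<-respˡ-≃ (ℚᵘ.≃-sym ∣ε∣) (ℚᵘ.*<* (+<+
    (ℕ.<-≤-trans 2[1+d]<1+n (ℕ.m≤m+n (suc n) (a * suc n))))))
    where
    ∣ε∣ : toℚᵘ ℚ.∣ ε (suc n) ∣ ℚᵘ.≃ mkℚᵘ (+ 2) n
    ∣ε∣ = ℚᵘ.≃-trans (ℚ.toℚᵘ-homo-∣-∣ (ε (suc n))) (ℚᵘ.∣-∣-cong (ℚ.toℚᵘ-fromℚᵘ (mkℚᵘ (+ 2) n)))

-- Four times the bound, free of subtraction. Rounding `r / 4` down costs at most `3 * X`, and the
-- summand 1 of `rowCount` at most `4 * X`.
G-bound : ∀ r → r ≥ 2 → 4 * G r + r * r ^ (r C 2) ≤ 4 * r ^ ((r + 1) C 2) + 8 * r ^ (r C 2)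
G-bound r@(suc p) r≥2 = begin
  4 * G r + r * X                           ≤⟨ ℕ.+-mono-≤ (ℕ.*-monoʳ-≤ 4 (G≤rowCount r r≥2)) rX≤ ⟩
  4 * rowCount r + (3 + s * 4) * X          ≡⟨ ring₁ (Z ∸ s * X) s X ⟩
  4 * (Z ∸ s * X + s * X) + (4 + 3 * X)     ≡⟨ cong (λ z → 4 * z + (4 + 3 * X)) (ℕ.m∸n+n≡m sX≤Z) ⟩
  4 * Z + (4 * 1 + 3 * X)                   ≤⟨ ℕ.+-monoʳ-≤ (4 * Z) (ℕ.+-monoˡ-≤ (3 * X) (ℕ.*-monoʳ-≤ 4 (ℕ.m^n>0 r (r C 2)))) ⟩
  4 * Z + (4 * X + 3 * X)                   ≤⟨ ℕ.+-monoʳ-≤ (4 * Z) (ℕ.m≤m+n _ X) ⟩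
  4 * Z + (4 * X + 3 * X + X)               ≡⟨ cong (_+_ (4 * Z)) (ring₂ X) ⟩
  4 * Z + 8 * X                             ∎
  where
  open ℕ.≤-Reasoning
  s = r / 4
  X = r ^ (r C 2)
  Z = r ^ ((r + 1) C 2)
  rX≤ : r * X ≤ (3 + s * 4) * X
  rX≤ = begin
    r * X               ≡⟨ cong (_* X) (m≡m%n+[m/n]*n r 4) ⟩
    (r % 4 + s * 4) * X ≤⟨ ℕ.*-monoˡ-≤ X (ℕ.+-monoˡ-≤ (s * 4) (s≤s⁻¹ (m%n<n r 4))) ⟩
    (3 + s * 4) * X     ∎
  sX≤Z : s * X ≤ Z
  sX≤Z = ℕ.≤-trans (ℕ.m≤m+n (s * X) _) (2*deficiency≤ p)
  ring₁ : ∀ y s X → 4 * (y + 1) + (3 + s * 4) * X ≡ 4 * (y + s * X) + (4 + 3 * X)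
  ring₁ = solve-∀
  ring₂ : ∀ X → 4 * X + 3 * X + X ≡ 8 * X
  ring₂ = solve-∀

quarter-bound : ∀ p a x z → 4 * a + suc p * x ≤ 4 * z + 8 * x →
  fromℕ a ℚ.≤ fromℕ z ℚ.- ((+ 1 ℚ./ 4) ℚ.- ε (suc p)) ℚ.* fromℕ (suc p * x)
quarter-bound p a x z 4a+w≤4z+8x = ℚ.*-cancelˡ-≤-pos 4ℚ (begin
  4ℚ ℚ.* A
    ≡⟨ ring₁ (4ℚ ℚ.* A) W ⟩
  4ℚ ℚ.* A ℚ.+ W ℚ.- W
    ≡⟨ cong (ℚ._- W) (trans (fromℕ-homo-+ (4 * a) w) (cong (ℚ._+ W) (fromℕ-homo-* 4 a))) ⟨
  fromℕ (4 * a + w) ℚ.- W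
    ≤⟨ ℚ.+-monoˡ-≤ (ℚ.- W) (fromℕ-mono-≤ 4a+w≤4z+8x) ⟩
  fromℕ (4 * z + 8 * x) ℚ.- W
    ≡⟨ cong (ℚ._- W) (trans (fromℕ-homo-+ (4 * z) (8 * x)) (cong₂ ℚ._+_ (fromℕ-homo-* 4 z) (fromℕ-homo-* 8 x))) ⟩
  4ℚ ℚ.* Z ℚ.+ fromℕ 8 ℚ.* X ℚ.- W
    -- The product `4ℚ ℚ.* ¼` computes to one, and 8 is rewritten as 4εr so that a common factor 4
    -- appears.
    ≡⟨ cong₂ (λ y v → 4ℚ ℚ.* Z ℚ.+ y ℚ.* X ℚ.- v) 4εr≡8 (ℚ.*-identityˡ W) ⟨
  4ℚ ℚ.* Z ℚ.+ 4ℚ ℚ.* (e ℚ.* R) ℚ.* X ℚ.- 4ℚ ℚ.* ¼ ℚ.* W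
    ≡⟨ cong (λ v → 4ℚ ℚ.* Z ℚ.+ 4ℚ ℚ.* (e ℚ.* R) ℚ.* X ℚ.- 4ℚ ℚ.* ¼ ℚ.* v) W≡ ⟩
  4ℚ ℚ.* Z ℚ.+ 4ℚ ℚ.* (e ℚ.* R) ℚ.* X ℚ.- 4ℚ ℚ.* ¼ ℚ.* (R ℚ.* X)
    ≡⟨ ring₂ 4ℚ ¼ e Z R X ⟩
  4ℚ ℚ.* (Z ℚ.- (¼ ℚ.- e) ℚ.* (R ℚ.* X))
    ≡⟨ cong (λ v → 4ℚ ℚ.* (Z ℚ.- (¼ ℚ.- e) ℚ.* v)) W≡ ⟨
  4ℚ ℚ.* (Z ℚ.- (¼ ℚ.- e) ℚ.* W) ∎)
  where
  open ℚ.≤-Reasoning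
  open +-*-Solver using (solve; _:=_; _:+_; _:*_; _:-_)
  w = suc p * x
  4ℚ = fromℕ 4
  ¼ = + 1 ℚ./ 4
  e = ε (suc p)
  R = fromℕ (suc p)
  A = fromℕ a
  X = fromℕ x
  Z = fromℕ z
  W = fromℕ w
  W≡ : W ≡ R ℚ.* X
  W≡ = fromℕ-homo-* (suc p) x
  4εr≡8 : 4ℚ ℚ.* (e ℚ.* R) ≡ fromℕ 8
  4εr≡8 = cong (4ℚ ℚ.*_) (ε*r≡2 p)
  ring₁ : ∀ x y → x ≡ x ℚ.+ y ℚ.- y
  ring₁ = solve 2 (λ x y → x := x :+ y :- y) refl
  ring₂ : ∀ f a e z r x → f ℚ.* z ℚ.+ f ℚ.* (e ℚ.* r) ℚ.* x ℚ.- f ℚ.* a ℚ.* (r ℚ.* x) ≡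
                          f ℚ.* (z ℚ.- (a ℚ.- e) ℚ.* (r ℚ.* x))
  ring₂ = solve 6 (λ f a e z r x → f :* z :+ f :* (e :* r) :* x :- f :* a :* (r :* x) :=
                                   f :* (z :- (a :- e) :* (r :* x))) refl

theorem1p3 :
  ((r : ℕ) → r ≥ 2 →
    let m = r ^ ((r + 1) C 2) ∸ (r / 4) * r ^ (r C 2) + 1
        n = ⌈ r ^ ((r + 1) C 2) /2⌉
    in g m n ≥ r + 1)
  ×
  (Σ[ ε ∈ (ℕ → ℚ) ] TendsToZero ε × ((r : ℕ) → r ≥ 2 →
    fromℕ (G r) ℚ.≤
      fromℕ (r ^ ((r + 1) C 2)) ℚ.- ((+ 1 ℚ./ 4) ℚ.- ε r) ℚ.* fromℕ (r ^ (r C 2 + 1))))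
theorem1p3 = g-bound , ε , ε→0 , G-bound′
  where
  G-bound′ : ∀ r → r ≥ 2 →
    fromℕ (G r) ℚ.≤
      fromℕ (r ^ ((r + 1) C 2)) ℚ.- ((+ 1 ℚ./ 4) ℚ.- ε r) ℚ.* fromℕ (r ^ (r C 2 + 1))
  -- With the exponent turned into `1 + r C 2`, the power unfolds to `r * r ^ (r C 2)`.
  G-bound′ r@(suc p) r≥2 = subst
    (λ w → fromℕ (G r) ℚ.≤ fromℕ (r ^ ((r + 1) C 2)) ℚ.- ((+ 1 ℚ./ 4) ℚ.- ε r) ℚ.* fromℕ (r ^ w))
    (ℕ.+-comm 1 (r C 2))
    (quarter-bound p (G r) (r ^ (r C 2)) (r ^ ((r + 1) C 2)) (G-bound r r≥2))
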